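{- Let $L, R, Z \in \mathbb{Z}$ be constants and let $\mathit{trav}_{L,R}^{Z}(a,s)$ be the program $$\texttt{for } i \texttt{ in } [L : s-R] \texttt{ do } !a[i+Z].$$ Then every subset $Q' \subseteq \mathbb{N}$ satisfying $$Q' \cap \{ s \in \mathbb{N} \mid s \geq L + R \} \neq \emptyset$$ is a completeness threshold for the array size $s$ (with domain $\mathbb{N}$) in the specification $\{\mathrm{array}(a,s)\}\ \mathit{trav}_{L,R}^{Z}(a,s)\ \{\mathrm{array}(a,s)\}$; that is, $$\models \forall s \in Q'.\ \{\mathrm{array}(a,s)\}\ \mathit{trav}_{L,R}^{Z}(a,s)\ \{\mathrm{array}(a,s)\} \quad\Longrightarrow\quad \models \forall s \in \mathbb{N}.\ \{\mathrm{array}(a,s)\}\ \mathit{trav}_{L,R}^{Z}(a,s)\ \{\mathrm{array}(a,s)\}.$$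
   Context: Here $\mathbb{N} = \{0,1,2,\dots\}$. Programs are written in a WHILE language with pointer arithmetic and a heap, where a heap is a finite partial map from locations to values. For a pointer $a$ and an integer $k$, $a[k]$ denotes the location at offset $k$ from $a$ (distinct offsets give distinct locations). The expression $!x$ reads the heap at location $x$; it is a runtime (memory) error if $x$ is not allocated in the current heap, and otherwise leaves the heap unchanged. The loop $\texttt{for } i \texttt{ in } [m : n] \texttt{ do } c$ executes $c$ successively for $i = m, m+1, \dots, n$ in ascending order (both bounds inclusive), and performs no iterations if $m > n$. The constants $L,R,Z$ are fixed; $a$ and $s$ are program variables. Assertions are those of a first-order affine (intuitionistic) separation logic: an assertion satisfied by a heap is also satisfied by every larger heap. The points-to assertion $x \mapsto v$ holds of heaps in which location $x$ is allocated and stores $v$; $x \mapsto \_$ means $\exists v.\ x \mapsto v$. The separating conjunction $A_1 * A_2$ holds of a heap that can be split into two disjoint heaps satisfying $A_1$ and $A_2$ respectively. For $s \in \mathbb{N}$, the predicate $\mathrm{array}(a,s)$ is equivalent to the iterated separating conjunction of $a[k] \mapsto \_$ over $0 \leq k < s$, i.e. $a$ points to a contiguous memory chunk of size $s$. Hoare triple: $\{A\}\ c\ \{B\}$ expresses that every execution of $c$ starting in a state satisfying $A$ encounters no runtime error, and either does not terminate or terminates in a state satisfying $B$. $\models$ denotes validity, in which remaining free variables (here the pointer $a$) are universally quantified. Completeness threshold: for a specification $\{A\}\ c\ \{B\}$ with a free variable $x$ of domain $X$, a subset $Q \subseteq X$ is called a completeness threshold for $x$ in $\{A\}\ c\ \{B\}$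 if $\models \forall x \in Q.\ \{A\}\ c\ \{B\}$ implies $\models \forall x \in X.\ \{A\}\ c\ \{B\}$. -}

module Defs where

open import Level using (0ℓ)
open import Data.Bool using (Bool; true; false; if_then_else_; not)
open import Data.Nat as ℕ using (ℕ; zero; suc)
open import Data.Integer as ℤ using (ℤ; +_)
open import Data.Maybe using (Maybe; just; nothing; _>>=_; _<∣>_; Is-just)
open import Data.List using (List; _∷_)
open import Data.List.Membership.Propositional using () renaming (_∈_ to _∈ˡ_)
open import Data.List.Relation.Unary.Any using (here; there)
open import Data.Product using (∃; _×_; _,_)
open import Data.Sum using (_⊎_; inj₁; inj₂)
open import Data.String using (String; _==_)
open import Data.Unit using (⊤; tt)
open import Relation.Unary using (Pred; _∈_; _⊆_; U)
open import Relation.Nullary using (¬_; yes; no; does)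
open import Relation.Binary using (DecidableEquality)
open import Relation.Binary.PropositionalEquality using (_≡_; _≢_; refl; sym; trans)
open import Relation.Binary.Construct.Closure.ReflexiveTransitive using (Star)

record PointerModel : Set₁ where
  field
    Loc              : Set
    _≟_              : DecidableEquality Loc
    _[_]             : Loc → ℤ → Loc
    offset-injective : ∀ p {j k} → p [ j ] ≡ p [ k ] → j ≡ k

Var : Set
Var = String

module Language (M : PointerModel) where

  open PointerModel M

  data Value : Set where
    int  : ℤ → Value
    bool : Bool → Value
    ptr  : Loc → Value

  Store : Set
  Store = Var → Value

  _⟦_↦_⟧ : Store → Var → Value → Store
  (σ ⟦ x ↦ v ⟧) y = if x == y then v else σ y

  -- The list only bounds the set of allocated locations; it is never consulted
  -- by the semantics.
  record Heap : Set where
    field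
      lookup  : Loc → Maybe Value
      support : List Loc
      finite  : ∀ l → Is-just (lookup l) → l ∈ˡ support

  open Heap public

  write : Heap → Loc → Value → Heap
  lookup  (write h l v) l′ = if does (l ≟ l′) then just v else lookup h l′
  support (write h l v)    = l ∷ support h
  finite  (write h l v) l′ p with l ≟ l′
  ... | yes refl = here refl
  ... | no  _    = there (finite h l′ p)

  infix 4 _⊑_ _＃_ _≐_⊎_

  _⊑_ : Heap → Heap → Set
  h ⊑ h′ = ∀ l v → lookup h l ≡ just v → lookup h′ l ≡ just v

  _＃_ : Heap → Heap → Set
  h₁ ＃ h₂ = ∀ l → lookup h₁ l ≡ nothing ⊎ lookup h₂ l ≡ nothing

  _≐_⊎_ : Heap → Heap → Heap → Set
  h ≐ h₁ ⊎ h₂ = h₁ ＃ h₂ × (∀ l → lookup h l ≡ (lookup h₁ l <∣> lookup h₂ l))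

  infixl 6 _⊕_ _⊖_
  infix  4 _≼_
  infix  8 !_

  data Expr : Set where
    var   : Var → Expr
    lit   : Value → Expr
    _⊕_   : Expr → Expr → Expr
    _⊖_   : Expr → Expr → Expr
    _≼_   : Expr → Expr → Expr
    neg   : Expr → Expr
    _[_]ₑ : Expr → Expr → Expr
    !_    : Expr → Expr

  asInt : Value → Maybe ℤ
  asInt (int k) = just k
  asInt _       = nothing

  asBool : Value → Maybe Bool
  asBool (bool b) = just b
  asBool _        = nothing

  asPtr : Value → Maybe Loc
  asPtr (ptr l) = just l
  asPtr _       = nothing

  -- The result `nothing` is a runtime error: a read of an unallocated location,
  -- or an operand of the wrong kind.
  mutual
    eval : Expr → Store → Heap → Maybe Value
    eval (var x)       σ h = just (σ x)
    eval (lit v)       σ h = just v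
    eval (e₁ ⊕ e₂)     σ h = do
      m ← evalInt e₁ σ h
      n ← evalInt e₂ σ h
      just (int (m ℤ.+ n))
    eval (e₁ ⊖ e₂)     σ h = do
      m ← evalInt e₁ σ h
      n ← evalInt e₂ σ h
      just (int (m ℤ.- n))
    eval (e₁ ≼ e₂)     σ h = do
      m ← evalInt e₁ σ h
      n ← evalInt e₂ σ h
      just (bool (does (m ℤ.≤? n)))
    eval (neg e)       σ h = do
      b ← evalBool e σ h
      just (bool (not b))
    eval (e₁ [ e₂ ]ₑ)  σ h = do
      l ← evalPtr e₁ σ h
      k ← evalInt e₂ σ h
      just (ptr (l [ k ]))
    eval (! e)         σ h = do
      l ← evalPtr e σ h
      lookup h l

    evalInt : Expr → Store → Heap → Maybe ℤ
    evalInt e σ h = eval e σ h >>= asInt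

    evalBool : Expr → Store → Heap → Maybe Bool
    evalBool e σ h = eval e σ h >>= asBool

    evalPtr : Expr → Store → Heap → Maybe Loc
    evalPtr e σ h = eval e σ h >>= asPtr

  infixr 5 _⨾_
  infix  6 _≔_ _*≔_

  data Cmd : Set where
    skip               : Cmd
    _⨾_                : Cmd → Cmd → Cmd
    _≔_                : Var → Expr → Cmd
    _*≔_               : Expr → Expr → Cmd      -- heap write
    expr               : Expr → Cmd             -- evaluate, discard the value
    if_then_else_end   : Expr → Cmd → Cmd → Cmd
    while_loop_          : Expr → Cmd → Cmd
    for_in[_∶_]loop_     : Var → Expr → Expr → Cmd → Cmd

  data Config : Set where
    ⟨_,_,_⟩ : Cmd → Store → Heap → Config
    error   : Config

  infix 3 _⟶_ _⟶*_

  data _⟶_ : Config → Config → Set where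

    seq-skip : ∀ {c σ h} → ⟨ skip ⨾ c , σ , h ⟩ ⟶ ⟨ c , σ , h ⟩
    seq-step : ∀ {c₁ c₁′ c₂ σ σ′ h h′} →
               ⟨ c₁ , σ , h ⟩ ⟶ ⟨ c₁′ , σ′ , h′ ⟩ →
               ⟨ c₁ ⨾ c₂ , σ , h ⟩ ⟶ ⟨ c₁′ ⨾ c₂ , σ′ , h′ ⟩
    seq-err  : ∀ {c₁ c₂ σ h} →
               ⟨ c₁ , σ , h ⟩ ⟶ error →
               ⟨ c₁ ⨾ c₂ , σ , h ⟩ ⟶ error

    assign     : ∀ {x e v σ h} → eval e σ h ≡ just v →
                 ⟨ x ≔ e , σ , h ⟩ ⟶ ⟨ skip , σ ⟦ x ↦ v ⟧ , h ⟩
    assign-err : ∀ {x e σ h} → eval e σ h ≡ nothing →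
                 ⟨ x ≔ e , σ , h ⟩ ⟶ error

    write-ok   : ∀ {e₁ e₂ l v w σ h} →
                 evalPtr e₁ σ h ≡ just l → eval e₂ σ h ≡ just v → lookup h l ≡ just w →
                 ⟨ e₁ *≔ e₂ , σ , h ⟩ ⟶ ⟨ skip , σ , write h l v ⟩
    write-err₁ : ∀ {e₁ e₂ σ h} → evalPtr e₁ σ h ≡ nothing →
                 ⟨ e₁ *≔ e₂ , σ , h ⟩ ⟶ error
    write-err₂ : ∀ {e₁ e₂ σ h} → eval e₂ σ h ≡ nothing →
                 ⟨ e₁ *≔ e₂ , σ , h ⟩ ⟶ error
    write-err₃ : ∀ {e₁ e₂ l σ h} → evalPtr e₁ σ h ≡ just l → lookup h l ≡ nothing →
                 ⟨ e₁ *≔ e₂ , σ , h ⟩ ⟶ error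

    expr-ok  : ∀ {e v σ h} → eval e σ h ≡ just v →
               ⟨ expr e , σ , h ⟩ ⟶ ⟨ skip , σ , h ⟩
    expr-err : ∀ {e σ h} → eval e σ h ≡ nothing →
               ⟨ expr e , σ , h ⟩ ⟶ error

    if-true  : ∀ {e c₁ c₂ σ h} → evalBool e σ h ≡ just true →
               ⟨ if e then c₁ else c₂ end , σ , h ⟩ ⟶ ⟨ c₁ , σ , h ⟩
    if-false : ∀ {e c₁ c₂ σ h} → evalBool e σ h ≡ just false →
               ⟨ if e then c₁ else c₂ end , σ , h ⟩ ⟶ ⟨ c₂ , σ , h ⟩
    if-err   : ∀ {e c₁ c₂ σ h} → evalBool e σ h ≡ nothing →
               ⟨ if e then c₁ else c₂ end , σ , h ⟩ ⟶ error

    while-true  : ∀ {e c σ h} → evalBool e σ h ≡ just true →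
                  ⟨ while e loop c , σ , h ⟩ ⟶ ⟨ c ⨾ (while e loop c) , σ , h ⟩
    while-false : ∀ {e c σ h} → evalBool e σ h ≡ just false →
                  ⟨ while e loop c , σ , h ⟩ ⟶ ⟨ skip , σ , h ⟩
    while-err   : ∀ {e c σ h} → evalBool e σ h ≡ nothing →
                  ⟨ while e loop c , σ , h ⟩ ⟶ error

    -- After the first iteration both bounds are literals, so they are evaluated
    -- only on entry and the body cannot disturb the iteration.
    for-iter : ∀ {x e₁ e₂ c m n σ h} →
               evalInt e₁ σ h ≡ just m → evalInt e₂ σ h ≡ just n → m ℤ.≤ n →
               ⟨ for x in[ e₁ ∶ e₂ ]loop c , σ , h ⟩ ⟶
               ⟨ (x ≔ lit (int m)) ⨾ c ⨾
                 (for x in[ lit (int (ℤ.suc m)) ∶ lit (int n) ]loop c) , σ , h ⟩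
    for-done : ∀ {x e₁ e₂ c m n σ h} →
               evalInt e₁ σ h ≡ just m → evalInt e₂ σ h ≡ just n → m ℤ.> n →
               ⟨ for x in[ e₁ ∶ e₂ ]loop c , σ , h ⟩ ⟶ ⟨ skip , σ , h ⟩
    for-err₁ : ∀ {x e₁ e₂ c σ h} → evalInt e₁ σ h ≡ nothing →
               ⟨ for x in[ e₁ ∶ e₂ ]loop c , σ , h ⟩ ⟶ error
    for-err₂ : ∀ {x e₁ e₂ c σ h} → evalInt e₂ σ h ≡ nothing →
               ⟨ for x in[ e₁ ∶ e₂ ]loop c , σ , h ⟩ ⟶ error

  _⟶*_ : Config → Config → Set
  _⟶*_ = Star _⟶_

  record Assertion : Set₁ where
    field
      holds  : Store → Heap → Set
      affine : ∀ {σ h h′} → h ⊑ h′ → holds σ h → holds σ h′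

  open Assertion public

  -- In an affine logic the empty separating conjunction is truth.
  emp : Assertion
  holds  emp _ _ = ⊤
  affine emp _ _ = tt

  infix 7 _↦_ _↦-
  infixr 6 _∗_

  _↦_ : Loc → Value → Assertion
  holds  (l ↦ v) _ h = lookup h l ≡ just v
  affine (l ↦ v) h⊑h′ p = h⊑h′ l v p

  ⌜_⌝ : (Store → Set) → Assertion
  holds  ⌜ P ⌝ σ _ = P σ
  affine ⌜ P ⌝ _ p = p

  infixr 5 _∧ₐ_

  _∧ₐ_ : Assertion → Assertion → Assertion
  holds  (A ∧ₐ B) σ h = holds A σ h × holds B σ h
  affine (A ∧ₐ B) h⊑h′ (p , q) = affine A h⊑h′ p , affine B h⊑h′ q

  ∃ₐ : {X : Set} → (X → Assertion) → Assertion
  holds  (∃ₐ A) σ h = ∃ λ x → holds (A x) σ h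
  affine (∃ₐ A) h⊑h′ (x , p) = x , affine (A x) h⊑h′ p

  _↦- : Loc → Assertion
  l ↦- = ∃ₐ λ v → l ↦ v

  _∖_ : Heap → Heap → Heap
  lookup  (h ∖ h₁) l with lookup h₁ l
  ... | just _  = nothing
  ... | nothing = lookup h l
  support (h ∖ h₁) = support h
  finite  (h ∖ h₁) l p with lookup h₁ l
  ... | nothing = finite h l p

  _∗_ : Assertion → Assertion → Assertion
  holds (A ∗ B) σ h = ∃ λ h₁ → ∃ λ h₂ → (h ≐ h₁ ⊎ h₂) × holds A σ h₁ × holds B σ h₂
  affine (A ∗ B) {h′ = h′} h⊑h′ (h₁ , h₂ , (h₁＃h₂ , h≐) , a , b) =
    h₁ , h′ ∖ h₁ , (disj , join) , a , affine B grow b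
    where
    disj : h₁ ＃ (h′ ∖ h₁)
    disj l with lookup h₁ l
    ... | just _  = inj₂ refl
    ... | nothing = inj₁ refl
    join : ∀ l → lookup h′ l ≡ (lookup h₁ l <∣> lookup (h′ ∖ h₁) l)
    join l with lookup h₁ l | h≐ l
    ... | just w  | eq = h⊑h′ l w eq
    ... | nothing | _  = refl
    grow : h₂ ⊑ (h′ ∖ h₁)
    grow l v eq with lookup h₁ l | h₁＃h₂ l | h≐ l
    ... | just _  | inj₂ none | _ with () ← trans (sym eq) none
    ... | nothing | _         | e = h⊑h′ l v (trans e eq)

  ✱[_] : (n : ℕ) → (ℕ → Assertion) → Assertion
  ✱[ zero  ] A = emp
  ✱[ suc n ] A = ✱[ n ] A ∗ A n

  array : Var → Var → Assertion
  array x y = ∃ₐ λ l → ∃ₐ λ n →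
    ⌜ (λ σ → σ x ≡ ptr l) ⌝ ∧ₐ ⌜ (λ σ → σ y ≡ int (+ n)) ⌝ ∧ₐ
    ✱[ n ] (λ k → (l [ + k ]) ↦-)

  -- `dom` gives the domain over which each variable ranges in the specification.
  record Spec : Set₁ where
    field
      dom  : Var → Pred Value 0ℓ
      pre  : Assertion
      cmd  : Cmd
      post : Assertion

  open Spec public

  infix 4 _⊨_ ⊨∀_∈_∙_

  _⊨_ : Store → Spec → Set
  σ ⊨ S = ∀ h → holds (pre S) σ h →
    ¬ (⟨ cmd S , σ , h ⟩ ⟶* error) ×
    (∀ σ′ h′ → ⟨ cmd S , σ , h ⟩ ⟶* ⟨ skip , σ′ , h′ ⟩ → holds (post S) σ′ h′)

  ⊨∀_∈_∙_ : ∀ {ℓ} → Var → Pred Value ℓ → Spec → Set ℓ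
  ⊨∀ x ∈ Q ∙ S = ∀ σ → σ x ∈ Q → (∀ y → y ≢ x → σ y ∈ dom S y) → σ ⊨ S

  IsCompletenessThreshold : ∀ {ℓ} → Var → Spec → Pred Value ℓ → Set ℓ
  IsCompletenessThreshold x S Q =
    Q ⊆ dom S x × ((⊨∀ x ∈ Q ∙ S) → (⊨∀ x ∈ dom S x ∙ S))

  pointers : Pred Value 0ℓ
  pointers v = ∃ λ l → v ≡ ptr l

  -- A set of naturals, seen as a set of values.
  nats : ∀ {ℓ} → Pred ℕ ℓ → Pred Value ℓ
  nats Q v = ∃ λ n → n ∈ Q × v ≡ int (+ n)

  a s i : Var
  a = "a"
  s = "s"
  i = "i"

  trav : (L R Z : ℤ) → Cmd
  trav L R Z =
    for i in[ lit (int L) ∶ var s ⊖ lit (int R) ]loop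
      expr (! (var a [ var i ⊕ lit (int Z) ]ₑ))

  travSpec : (L R Z : ℤ) → Spec
  dom  (travSpec L R Z) "a" = pointers
  dom  (travSpec L R Z) "s" = nats U
  dom  (travSpec L R Z) _   = U
  pre  (travSpec L R Z)     = array a s
  cmd  (travSpec L R Z)     = trav L R Z
  post (travSpec L R Z)     = array a s

{-# OPTIONS --safe #-}

-- If L ≤ s - R, the loop reads exactly the offsets L + Z, …, s - R + Z, and these
-- all lie in [0, s) iff 0 ≤ L + Z and Z < R, a condition independent of s.  If
-- L > s - R, the loop reads nothing.  So validity at a single s ≥ L + R, tested on
-- a heap containing nothing but the array, yields validity at every s.

module Submission where

open import Data.Nat using (ℕ)
open import Data.Integer using (ℤ; +_; _+_; _≥_)
open import Relation.Nullary using (¬_)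
open import Relation.Unary using (Pred; Empty; _∩_)
open import Defs

open import Data.Nat as ℕ using (zero; suc)
import Data.Nat.Properties as ℕₚ
open import Data.Integer as ℤ using (_-_; -_; _≤_; _<_; +≤+; +<+)
import Data.Integer.Properties as ℤₚ
open import Data.Integer.Tactic.RingSolver using (solve-∀)
open import Data.Maybe using (just; nothing; _<∣>_)
open import Data.List using ([])
open import Data.Product using (∃; _×_; _,_; proj₁; proj₂)
open import Data.Sum using (inj₁; inj₂)
import Data.String.Properties as String
open import Data.Unit using (tt)
open import Function using (case_of_)
open import Relation.Nullary using (yes; no; contradiction; Dec; decidable-stable)
open import Relation.Nullary.Decidable using (_×-dec_)
open import Relation.Unary using (_∈_)
open import Relation.Binary.PropositionalEquality hiding ([_])
open import Relation.Binary.Construct.Closure.ReflexiveTransitive using (ε; _◅_)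

-- Integer arithmetic of the loop bounds.

InBounds : (L R Z : ℤ) → Set
InBounds L R Z = + 0 ≤ L + Z × Z < R

inBounds? : ∀ L R Z → Dec (InBounds L R Z)
inBounds? L R Z = (+ 0 ℤ.≤? L + Z) ×-dec (Z ℤ.<? R)

-- Monotonicity reduces the lower end to `L + Z`; at the upper end, `k ≤ n - R` and `Z < R` add up
-- to `k + Z < n`.
inBounds⇒index : ∀ {L R Z} n {k} → InBounds L R Z → L ≤ k → k ≤ + n - R →
                 ∃ λ j → j ℕ.< n × k + Z ≡ + j
inBounds⇒index {L} {R} {Z} n {k} (0≤L+Z , Z<R) L≤k k≤n-R =
  natural (ℤₚ.≤-trans 0≤L+Z (ℤₚ.+-monoˡ-≤ Z L≤k)) below
  where
  cancel : ∀ x y → x - y + y ≡ x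
  cancel = solve-∀
  below : k + Z < + n
  below = subst (k + Z <_) (cancel (+ n) R) (ℤₚ.+-mono-≤-< k≤n-R Z<R)
  natural : ∀ {x} → + 0 ≤ x → x < + n → ∃ λ j → j ℕ.< n × x ≡ + j
  natural (+≤+ _) (+<+ j<n) = _ , j<n , refl

-- The extreme indices suffice: the first one bounds from below, and adding `R - n` to both sides of
-- `n - R + Z < n` leaves `Z < R`.
indices⇒inBounds : ∀ {L R Z n} →
                   (∃ λ j → j ℕ.< n × L + Z ≡ + j) →
                   (∃ λ j → j ℕ.< n × + n - R + Z ≡ + j) →
                   InBounds L R Z
indices⇒inBounds {L} {R} {Z} {n} (_ , _ , first≡) (j , j<n , last≡) =
  subst (+ 0 ≤_) (sym first≡) (+≤+ ℕ.z≤n) ,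
  subst₂ _<_ (shift (+ n) R Z) (cancel R (+ n))
    (ℤₚ.+-monoˡ-< (R - + n) (subst (_< + n) (sym last≡) (+<+ j<n)))
  where
  shift : ∀ x y z → x - y + z + (y - x) ≡ z
  shift = solve-∀
  cancel : ∀ y x → x + (y - x) ≡ y
  cancel = solve-∀

+-≤⇒≤-minus : ∀ {x y z} → x + y ≤ z → x ≤ z - y
+-≤⇒≤-minus {x} {y} {z} x+y≤z =
  subst (_≤ z - y) (cancel x y) (ℤₚ.+-monoˡ-≤ (- y) x+y≤z)
  where
  cancel : ∀ x y → x + y - y ≡ x
  cancel = solve-∀

-- Stores, heaps and the array predicate.

module _ (M : PointerModel) where

  open PointerModel M
  open Language M

  ⟦↦⟧-other : ∀ (σ : Store) {x y} v → y ≢ x → (σ ⟦ x ↦ v ⟧) y ≡ σ y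
  ⟦↦⟧-other σ {x} {y} v y≢x with x String.≟ y
  ... | yes x≡y = contradiction (sym x≡y) y≢x
  ... | no  _   = refl

  Allocated : Heap → Loc → Set
  Allocated h l = ∃ λ v → lookup h l ≡ just v

  -- Safety is a negative statement; case analysis on `lookup` is what extracts a stored value from
  -- it.
  allocated-stable : ∀ {h l} → (lookup h l ≢ nothing) → Allocated h l
  allocated-stable {h} {l} ≢nothing with lookup h l
  ... | just v  = v , refl
  ... | nothing = contradiction refl ≢nothing

  empty : Heap
  lookup  empty _ = nothing
  support empty   = []
  finite  empty _ ()

  lookup-write-same : ∀ h l v → lookup (write h l v) l ≡ just v
  lookup-write-same h l v with l ≟ l
  ... | yes _   = refl
  ... | no  l≢l = contradiction refl l≢l

  -- Pointwise counterpart of the iterated separating conjunction: distinct offsets are distinct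
  -- locations, so no heap splitting has to be tracked.
  Block : Loc → ℕ → Heap → Set
  Block l n h = ∀ {k} → k ℕ.< n → Allocated h (l [ + k ])

  block : Loc → ℕ → Heap
  block l zero    = empty
  block l (suc n) = write (block l n) (l [ + n ]) (int (+ 0))

  block-Block : ∀ l n → Block l n (block l n)
  block-Block l (suc n) {k} k<1+n with (l [ + n ]) ≟ (l [ + k ])
  ... | yes _   = _ , refl
  ... | no  ≢k  = block-Block l n
    (ℕₚ.≤∧≢⇒< (ℕₚ.≤-pred k<1+n) λ k≡n → ≢k (cong (λ j → l [ + j ]) (sym k≡n)))

  -- By `offset-injective`, an integer offset outside the range cannot alias a cell of the array, so
  -- an out-of-bounds read of this heap must fault.
  block-domain : ∀ l n {k} → Allocated (block l n) (l [ k ]) → ∃ λ j → j ℕ.< n × k ≡ + j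
  block-domain l (suc n) {k} alloc with (l [ + n ]) ≟ (l [ k ])
  ... | yes n≡k = n , ℕₚ.n<1+n n , sym (offset-injective l n≡k)
  ... | no  _   with j , j<n , k≡j ← block-domain l n alloc = j , ℕₚ.m<n⇒m<1+n j<n , k≡j

  cells : Loc → ℕ → Assertion
  cells l n = ✱[ n ] (λ k → (l [ + k ]) ↦-)

  cells⇒Block : ∀ {l} n {σ h} → holds (cells l n) σ h → Block l n h
  cells⇒Block {l} (suc n) (h₁ , h₂ , (h₁＃h₂ , h≐) , low , v , last) {k} k<1+n
    with ℕₚ.m<1+n⇒m<n∨m≡n k<1+n
  ... | inj₁ k<n with w , eq ← cells⇒Block n low k<n =
    w , trans (h≐ _) (cong (_<∣> lookup h₂ (l [ + k ])) eq)
  ... | inj₂ refl with h₁＃h₂ (l [ + n ])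
  ...   | inj₁ none = v , trans (h≐ _) (trans (cong (_<∣> lookup h₂ (l [ + n ])) none) last)
  ...   | inj₂ none with () ← trans (sym none) last

  ∖-cell : ∀ {h l v} → lookup h l ≡ just v → h ≐ h ∖ write empty l v ⊎ write empty l v
  ∖-cell {h} {l} {v} eq = disjoint , join
    where
    disjoint : h ∖ write empty l v ＃ write empty l v
    disjoint x with l ≟ x
    ... | yes _ = inj₁ refl
    ... | no  _ = inj₂ refl
    join : ∀ x → lookup h x ≡ (lookup (h ∖ write empty l v) x <∣> lookup (write empty l v) x)
    join x with l ≟ x
    ... | yes refl = eq
    ... | no  _    with lookup h x
    ...   | just _  = refl
    ...   | nothing = refl

  lookup-∖-cell : ∀ h {l l′} v → l ≢ l′ → lookup (h ∖ write empty l v) l′ ≡ lookup h l′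
  lookup-∖-cell h {l} {l′} v l≢l′ with l ≟ l′
  ... | yes l≡l′ = contradiction l≡l′ l≢l′
  ... | no  _    = refl

  -- Splits off the last cell as a singleton heap; the lower cells survive its removal because their
  -- offsets differ from `n`.
  Block⇒cells : ∀ {l} n {σ h} → Block l n h → holds (cells l n) σ h
  Block⇒cells         zero        _  = tt
  Block⇒cells {l} (suc n) {h = h} bl with v , eq ← bl (ℕₚ.n<1+n n) =
    h ∖ cell , cell , ∖-cell eq , Block⇒cells n rest , v , lookup-write-same empty _ v
    where
    cell : Heap
    cell = write empty (l [ + n ]) v
    rest : Block l n (h ∖ cell)
    rest {k} k<n with w , eq′ ← bl (ℕₚ.m<n⇒m<1+n k<n) =
      w , trans (lookup-∖-cell h v λ n≡k →
                   ℕₚ.<⇒≢ k<n (sym (ℤₚ.+-injective (offset-injective l n≡k)))) eq′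

  -- Executions of the loop.

  module _ (Z : ℤ) where

    access : Cmd
    access = expr (! (var a [ var i ⊕ lit (int Z) ]ₑ))

    loop-from : ℤ → ℤ → Cmd
    loop-from m n = for i in[ lit (int m) ∶ lit (int n) ]loop access

    eval-access : ∀ {σ h l k} → σ a ≡ ptr l → σ i ≡ int k →
                  eval (! (var a [ var i ⊕ lit (int Z) ]ₑ)) σ h ≡ lookup h (l [ k + Z ])
    eval-access σa σi rewrite σa | σi = refl

    -- Induction on `d`, the number of iterations before the bad read. Arbitrary `e₁` and `e₂` cover
    -- both the original loop and its unfoldings, whose bounds are literals.
    loop-reads : ∀ {e₁ e₂ m n l} d {σ h} →
                 evalInt e₁ σ h ≡ just m → evalInt e₂ σ h ≡ just n → σ a ≡ ptr l →
                 m + + d ≤ n → lookup h (l [ m + + d + Z ]) ≡ nothing →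
                 ⟨ for i in[ e₁ ∶ e₂ ]loop access , σ , h ⟩ ⟶* error
    loop-reads {m = m} {n} {l} d {σ} {h} e₁≡m e₂≡n σa m+d≤n none =
      for-iter e₁≡m e₂≡n (ℤₚ.≤-trans (ℤₚ.i≤i+j m (+ d)) m+d≤n) ◅
      seq-step (assign refl) ◅ seq-skip ◅ continue d m+d≤n none
      where
      σ′ : Store
      σ′ = σ ⟦ i ↦ int m ⟧
      continue : ∀ d → m + + d ≤ n → lookup h (l [ m + + d + Z ]) ≡ nothing →
                 ⟨ access ⨾ loop-from (ℤ.suc m) n , σ′ , h ⟩ ⟶* error
      continue d m+d≤n none with lookup h (l [ m + Z ]) in eq
      -- A fault before the targeted iteration also reaches `error`, so nothing need be known about
      -- the earlier reads.
      continue _ _ _ | nothing =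
        seq-err (expr-err (trans (eval-access {σ′} {h} σa refl) eq)) ◅ ε
      continue zero _ none | just _
        with () ← trans (sym eq) (subst (λ k → lookup h (l [ k + Z ]) ≡ nothing) (ℤₚ.+-identityʳ m) none)
      continue (suc d) m+d≤n none | just _ =
        seq-step (expr-ok (trans (eval-access {σ′} {h} σa refl) eq)) ◅ seq-skip ◅
        loop-reads d refl refl σa
          (subst (_≤ n) (move m (+ d)) m+d≤n)
          (subst (λ k → lookup h (l [ k + Z ]) ≡ nothing) (move m (+ d)) none)
        where
        move : ∀ x y → x + (+ 1 + y) ≡ + 1 + x + y
        move = solve-∀

    -- The configurations reachable by a loop all of whose reads succeed; σ₀ is the
    -- initial store and h the heap, which never changes.
    module _ (σ₀ : Store) (l : Loc) (h : Heap) (σ₀a : σ₀ a ≡ ptr l) where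

      -- The loop overwrites `i`; the reads depend on the initial value of `a`, and the
      -- postcondition on those of `a` and `s`.
      record Agrees (σ : Store) : Set where
        constructor _,_
        field
          agrees-a : σ a ≡ σ₀ a
          agrees-s : σ s ≡ σ₀ s

      Readable : ℤ → ℤ → Set
      Readable m n = ∀ k → m ≤ k → k ≤ n → Allocated h (l [ k + Z ])

      data Safe : Config → Set where
        looping   : ∀ {e₁ e₂ m n σ} → Agrees σ →
                    evalInt e₁ σ h ≡ just m → evalInt e₂ σ h ≡ just n → Readable m n →
                    Safe ⟨ for i in[ e₁ ∶ e₂ ]loop access , σ , h ⟩
        assigning : ∀ {m n σ} → Agrees σ → m ≤ n → Readable m n →
                    Safe ⟨ (i ≔ lit (int m)) ⨾ access ⨾ loop-from (ℤ.suc m) n , σ , h ⟩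
        assigned  : ∀ {m n σ} → Agrees σ → σ i ≡ int m → m ≤ n → Readable m n →
                    Safe ⟨ skip ⨾ access ⨾ loop-from (ℤ.suc m) n , σ , h ⟩
        accessing : ∀ {m n σ} → Agrees σ → σ i ≡ int m → m ≤ n → Readable m n →
                    Safe ⟨ access ⨾ loop-from (ℤ.suc m) n , σ , h ⟩
        accessed  : ∀ {m n σ} → Agrees σ → Readable (ℤ.suc m) n →
                    Safe ⟨ skip ⨾ loop-from (ℤ.suc m) n , σ , h ⟩
        finished  : ∀ {σ} → Agrees σ → Safe ⟨ skip , σ , h ⟩

      -- `Safe` has no constructor for `error`, so preservation includes refuting every faulting
      -- step.
      safe-step : ∀ {c c′} → Safe c → c ⟶ c′ → Safe c′
      safe-step (looping ag p q r) (for-iter p′ q′ m≤n)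
        with refl ← trans (sym p) p′ | refl ← trans (sym q) q′ = assigning ag m≤n r
      safe-step (looping ag _ _ _) (for-done _ _ _) = finished ag
      safe-step (looping _ p _ _) (for-err₁ p′) with () ← trans (sym p) p′
      safe-step (looping _ _ q _) (for-err₂ q′) with () ← trans (sym q) q′
      -- The literals for `a` and `s` differ from `i`, so the store update computes away and the old
      -- proofs fit the new store.
      safe-step (assigning (ag-a , ag-s) m≤n r) (seq-step (assign refl)) =
        assigned (ag-a , ag-s) refl m≤n r
      safe-step (assigning _ _ _) (seq-err (assign-err ()))
      safe-step (assigned ag σi m≤n r) seq-skip = accessing ag σi m≤n r
      safe-step (accessing {m} ag _ _ r) (seq-step (expr-ok _)) =
        accessed {m} ag λ k 1+m≤k → r k (ℤₚ.≤-trans (ℤₚ.i≤suc[i] m) 1+m≤k)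
      safe-step (accessing {m} {σ = σ} ag σi m≤n r) (seq-err (expr-err err))
        with v , eq ← r m ℤₚ.≤-refl m≤n
        with () ← trans (sym err) (trans (eval-access {σ} {h} (trans (Agrees.agrees-a ag) σ₀a) σi) eq)
      safe-step (accessed ag r) seq-skip = looping ag refl refl r

      safe-steps : ∀ {c c′} → Safe c → c ⟶* c′ → Safe c′
      safe-steps safe ε              = safe
      safe-steps safe (step ◅ steps) = safe-steps (safe-step safe step) steps

      safe-skip : ∀ {σ h′} → Safe ⟨ skip , σ , h′ ⟩ → Agrees σ × h′ ≡ h
      safe-skip (finished ag) = ag , refl

  -- The bounds condition and validity of the triple.

  eval-bound : ∀ {σ : Store} {h n} R → σ s ≡ int (+ n) →
               evalInt (var s ⊖ lit (int R)) σ h ≡ just (+ n - R)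
  eval-bound R σs rewrite σs = refl

  inBounds⇒valid : ∀ {L R Z} → InBounds L R Z → ∀ σ → σ ⊨ travSpec L R Z
  inBounds⇒valid {L} {R} {Z} ib σ h (l , n , σa , σs , arr) =
    (λ steps → case safe-steps Z σ l h σa start steps of λ ()) ,
    λ σ′ h′ steps → case safe-skip Z σ l h σa (safe-steps Z σ l h σa start steps) of λ where
      ((ag-a , ag-s) , refl) →
        -- `arr` holds under the initial store; passing through `Block`, which mentions no store,
        -- carries it over to `σ′`.
        l , n , trans ag-a σa , trans ag-s σs , Block⇒cells n (cells⇒Block n arr)
    where
    readable : Readable Z σ l h σa L (+ n - R)
    readable k L≤k k≤n-R with j , j<n , k+Z≡j ← inBounds⇒index n ib L≤k k≤n-R =
      subst (λ o → Allocated h (l [ o ])) (sym k+Z≡j) (cells⇒Block n arr j<n)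
    start : Safe Z σ l h σa ⟨ trav L R Z , σ , h ⟩
    start = looping (refl , refl) refl (eval-bound {σ} {h} R σs) readable

  -- Since `L ≤ n - R`, the iterations at `L` and at `n - R` both occur; on the minimal heap their
  -- safety forces both offsets to be array indices.
  valid⇒inBounds : ∀ {L R Z} σ {l n} → σ a ≡ ptr l → σ s ≡ int (+ n) → + n ≥ L + R →
                   σ ⊨ travSpec L R Z → InBounds L R Z
  valid⇒inBounds {L} {R} {Z} σ {l} {n} σa σs n≥L+R valid =
    indices⇒inBounds {L} (read L ℤₚ.≤-refl L≤n-R) (read (+ n - R) L≤n-R ℤₚ.≤-refl)
    where
    L≤n-R : L ≤ + n - R
    L≤n-R = +-≤⇒≤-minus n≥L+R
    h : Heap
    h = block l n
    safe : ¬ (⟨ trav L R Z , σ , h ⟩ ⟶* error)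
    safe = proj₁ (valid h (l , n , σa , σs , Block⇒cells n (block-Block l n)))
    distance : ∀ {x y} → x ≤ y → ∃ λ d → x + + d ≡ y
    distance {x} {y} x≤y = ℤ.∣ y - x ∣ ,
      trans (cong (λ z → x + z) (ℤₚ.0≤i⇒+∣i∣≡i (ℤₚ.i≤j⇒0≤j-i x≤y))) (cancel x y)
      where
      cancel : ∀ x y → x + (y - x) ≡ y
      cancel = solve-∀
    read : ∀ k → L ≤ k → k ≤ + n - R → ∃ λ j → j ℕ.< n × k + Z ≡ + j
    read k L≤k k≤n-R with d , refl ← distance L≤k =
      block-domain l n (allocated-stable {h} λ none →
        safe (loop-reads Z d refl (eval-bound {σ} {h} R σs) σa k≤n-R none))

mainTheorem1 : (M : PointerModel) (L R Z : ℤ) → let open Language M in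
    ∀ {ℓ} (Q′ : Pred ℕ ℓ) →
    ¬ Empty (Q′ ∩ (λ n → + n ≥ L + R)) →
    IsCompletenessThreshold s (travSpec L R Z) (nats Q′)
mainTheorem1 M L R Z Q′ nonempty =
  (λ (n , _ , v≡n) → n , tt , v≡n) ,
  λ validOnQ′ σ _ others → inBounds⇒valid M (inBounds validOnQ′ σ others) σ
  where
  open Language M
  inBounds : (⊨∀ s ∈ nats Q′ ∙ travSpec L R Z) →
             ∀ σ → (∀ y → y ≢ s → σ y ∈ dom (travSpec L R Z) y) → InBounds L R Z
  -- `nonempty` yields no witness, only a refutation of emptiness; decidability of `InBounds` allows
  -- arguing by contradiction.
  inBounds validOnQ′ σ others = decidable-stable (inBounds? L R Z) λ ¬ib →
    nonempty λ n (n∈Q′ , n≥L+R) → ¬ib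
      (valid⇒inBounds M (resize n) (proj₂ (others a λ ())) refl n≥L+R
        (validOnQ′ (resize n) (n , n∈Q′ , refl) λ y y≢s →
          subst (_∈ dom (travSpec L R Z) y) (sym (⟦↦⟧-other M σ (int (+ n)) y≢s)) (others y y≢s)))
    where
    -- The hypothesis applies only to sizes in `Q′`, so `σ` is tested with its size replaced by `n`
    -- and its pointer kept.
    resize : ℕ → Store
    resize n = σ ⟦ s ↦ int (+ n) ⟧
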